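{- Let $G=(X,\Gamma,M)$ be a normal twin-orthogonal vertex-weighted graph, let $G^*=(X,\Gamma^*,M)$ be its conjugate graph, and let $\hat U\subseteq X$ be a maximal independent set (MIS) of $G$. Then $\hat U$ is a maximum independent set (MMIS) of $G$ if and only if $\Gamma\hat U=X\setminus\hat U$ is a minimum independent set (MNMIS) of $G^*$.
   Context: A vertex-weighted graph $G=(X,\Gamma,M)$ is a finite undirected graph without loops or multiple edges, with vertex set $X$, where $\Gamma x$ is the set of neighbours of $x$, $\Gamma A=\bigcup_{x\in A}\Gamma x$ for $A\subseteq X$, and $M$ assigns to each vertex $x$ a non-negative integer weight $\mu(x)$. For $A\subseteq X$ put $\mu(A)=\sum_{x\in A}\mu(x)$. A set $U\subseteq X$ is independent if $U\cap\Gamma U=\emptyset$; it is a maximal independent set (MIS) if in addition $U\cup\Gamma U=X$. A MIS that maximizes $\mu(U)$ among all MISs of the graph is called a maximum independent set (MMIS); a MIS that minimizes $\mu(U)$ among all MISs of the graph is called a minimum independent set (MNMIS). $G$ is normal if $\Gamma x\neq\Gamma y$ for any two distinct vertices $x,y$. Adjacent vertices $x_1,x_2$ of a normal graph are orthogonal if $\Gamma x_2\subseteq\Gamma x_{i_1}$ for every $x_{i_1}\in\Gamma x_1\setminus\{x_2\}$ and $\Gamma x_1\subseteq\Gamma x_{i_2}$ for every $x_{i_2}\in\Gamma x_2\setminus\{x_1\}$ (each condition vacuous if there are no such vertices). A normal vertex-weighted graph is twin-orthogonal if its vertex set can be partitioned into pairs of orthogonal vertices; the partner of $x$ is denoted $x^*$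 (so $(x^*)^*=x$). The conjugate graph $G^*=(X,\Gamma^*,M)$ of $G$ is obtained by swapping the names of the two vertices within each orthogonal pair, the weight $\mu(x)$ of each element $x$ of $X$ being unchanged: $x$ and $x^*$ are adjacent in $G^*$ for every $x$, and non-orthogonal vertices $x_i,x_j$ are adjacent in $G^*$ if and only if $x_i^*,x_j^*$ are adjacent in $G$. -}

module Defs where

open import Data.Bool.Base using (true)
open import Data.Fin.Base using (Fin)
open import Data.Fin.Properties using (_≟_)
open import Data.Fin.Subset using (Subset; _∈_; _∉_; _⊆_; _∩_; _∪_; _-_; ⊥; ⊤; ⋃)
open import Data.Fin.Subset.Properties using (_∈?_)
open import Data.List.Base using (List; allFin; filter; map; sum)
open import Data.Nat.Base using (ℕ; _≤_)
open import Data.Product.Base using (_×_; _,_)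
open import Data.Sum.Base using (_⊎_; inj₁; inj₂)
open import Data.Vec.Base using (tabulate)
open import Data.Vec.Properties using (lookup⇒[]=; []=⇒lookup; lookup∘tabulate)
open import Relation.Binary.PropositionalEquality using (_≡_; _≢_; sym; trans; cong; subst)
open import Relation.Nullary.Decidable using (Dec; does; yes; no; dec-true; ¬?; _×-dec_; _⊎-dec_)
open import Relation.Nullary.Negation using (¬_; contradiction)

private
  variable
    n : ℕ

-- The vertex set X is Fin n.  Vertex sets are elements of Subset n, on which
-- _≡_ is extensional equality of sets.
record VertexWeightedGraph (n : ℕ) : Set where
  field
    Γ        : Fin n → Subset n
    Γ-sym    : ∀ {x y} → y ∈ Γ x → x ∈ Γ y
    Γ-irrefl : ∀ {x} → x ∉ Γ x
    μ        : Fin n → ℕ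

  members : Subset n → List (Fin n)
  members A = filter (_∈? A) (allFin n)

  Γ[_] : Subset n → Subset n
  Γ[ A ] = ⋃ (map Γ (members A))

  μ[_] : Subset n → ℕ
  μ[ A ] = sum (map μ (members A))

module _ (G : VertexWeightedGraph n) where
  open VertexWeightedGraph G

  Independent : Subset n → Set
  Independent U = U ∩ Γ[ U ] ≡ ⊥

  MIS : Subset n → Set
  MIS U = Independent U × U ∪ Γ[ U ] ≡ ⊤

  -- MMIS and MNMIS are optimal in weight among the inclusion-maximal
  -- independent sets only, not among all independent sets.
  MMIS : Subset n → Set
  MMIS U = MIS U × (∀ V → MIS V → μ[ V ] ≤ μ[ U ])

  MNMIS : Subset n → Set
  MNMIS U = MIS U × (∀ V → MIS V → μ[ U ] ≤ μ[ V ])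

  Normal : Set
  Normal = ∀ x y → x ≢ y → Γ x ≢ Γ y

  Orthogonal : Fin n → Fin n → Set
  Orthogonal x₁ x₂ =
    x₂ ∈ Γ x₁ ×
    (∀ y → y ∈ Γ x₁ - x₂ → Γ x₂ ⊆ Γ y) ×
    (∀ y → y ∈ Γ x₂ - x₁ → Γ x₁ ⊆ Γ y)

  -- A partition of the vertices into orthogonal pairs, given by its partner
  -- map.  Orthogonal vertices are adjacent, so x * ≢ x by Γ-irrefl and the
  -- classes { x , x * } do have two elements.
  record TwinOrthogonal : Set where
    infix 9 _*
    field
      _*           : Fin n → Fin n
      *-involutive : ∀ x → (x *) * ≡ x
      *-orthogonal : ∀ x → Orthogonal x (x *)

subset : {P : Fin n → Set} → (∀ x → Dec (P x)) → Subset n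
subset P? = tabulate (λ x → does (P? x))

module _ {P : Fin n → Set} (P? : ∀ x → Dec (P x)) where

  ∈-subset⁺ : ∀ {x} → P x → x ∈ subset P?
  ∈-subset⁺ {x} px = lookup⇒[]= x (subset P?)
    (trans (lookup∘tabulate (λ z → does (P? z)) x) (dec-true (P? x) px))

  ∈-subset⁻ : ∀ {x} → x ∈ subset P? → P x
  ∈-subset⁻ {x} x∈ = extract (P? x)
    (trans (sym (lookup∘tabulate (λ z → does (P? z)) x)) ([]=⇒lookup x∈))
    where
    extract : (d : Dec (P x)) → does d ≡ true → P x
    extract (yes px) _  = px
    extract (no _)   ()

module _ (G : VertexWeightedGraph n) (T : TwinOrthogonal G) where
  open VertexWeightedGraph G
  open TwinOrthogonal T

  -- In a normal graph the only vertex orthogonal to x is x *, so for distinct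
  -- vertices "y is not orthogonal to x" is y ≢ x *.  The case y ≡ x of the
  -- second alternative never holds, by Γ-irrefl.
  Adjacent* : Fin n → Fin n → Set
  Adjacent* x y = y ≡ x * ⊎ (y ≢ x * × y * ∈ Γ (x *))

  adjacent*? : ∀ x y → Dec (Adjacent* x y)
  adjacent*? x y = (y ≟ x *) ⊎-dec (¬? (y ≟ x *) ×-dec (y * ∈? Γ (x *)))

  private
    flip* : ∀ {x y} → y ≡ x * → x ≡ y *
    flip* {x} y≡x* = trans (sym (*-involutive x)) (cong _* (sym y≡x*))

    adjacent*-sym : ∀ {x y} → Adjacent* x y → Adjacent* y x
    adjacent*-sym (inj₁ y≡x*)         = inj₁ (flip* y≡x*)
    adjacent*-sym (inj₂ (y≢x* , adj)) = inj₂ ((λ x≡y* → y≢x* (flip* x≡y*)) , Γ-sym adj)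

    adjacent*-irrefl : ∀ {x} → ¬ Adjacent* x x
    adjacent*-irrefl {x} (inj₁ x≡x*) with *-orthogonal x
    ... | x*∈Γx , _ = contradiction (subst (_∈ Γ x) (sym x≡x*) x*∈Γx) Γ-irrefl
    adjacent*-irrefl (inj₂ (_ , adj)) = contradiction adj Γ-irrefl

  conjugate : VertexWeightedGraph n
  conjugate = record
    { Γ        = λ x → subset (adjacent*? x)
    ; Γ-sym    = λ {x} {y} y∈ →
        ∈-subset⁺ (adjacent*? y) (adjacent*-sym (∈-subset⁻ (adjacent*? x) y∈))
    ; Γ-irrefl = λ {x} x∈ → adjacent*-irrefl (∈-subset⁻ (adjacent*? x) x∈)
    ; μ        = μ
    }

{-# OPTIONS --safe #-}

-- In a twin-orthogonal graph the maximal independent sets are exactly the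
-- independent sets U that contain one vertex of each pair: if U met neither x
-- nor x *, maximality would give neighbours u of x and v of x * in U, and
-- orthogonality would make u and v adjacent.  G* is twin-orthogonal with the
-- same pairs, and complementing such a set amounts to applying _*, which
-- exchanges independence in G with independence in G*.  So U ↦ ∁ U is a
-- weight-reversing correspondence between the MISs of G and those of G*.
module Submission where

open import Algebra.Lattice.Properties.BooleanAlgebra as BooleanAlgebra using ()
open import Data.Fin.Base using (Fin)
open import Data.Fin.Properties using (_≟_)
open import Data.Fin.Subset using (Subset; ∁; _∈_; _∉_; _∪_; _-_; ⁅_⁆; ⋃)
open import Data.Fin.Subset.Properties
open import Data.List.Base using ([]; _∷_; allFin; filter; map)
open import Data.List.Membership.Propositional as List using ()
open import Data.List.Membership.Propositional.Properties using (∈-allFin; ∈-map∘filter⁺; ∈-map∘filter⁻)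
open import Data.List.Relation.Unary.Any using (here; there)
open import Data.Nat.Base using (ℕ; _+_; _≤_)
open import Data.Nat.ListAction using (sum)
open import Data.Nat.Properties using (+-assoc; +-cancelˡ-≤; +-monoˡ-≤; +-commutativeSemigroup; module ≤-Reasoning)
open import Algebra.Properties.CommutativeSemigroup +-commutativeSemigroup using (x∙yz≈y∙xz)
open import Data.Product.Base using (_×_; _,_; proj₁; proj₂; ∃-syntax)
open import Data.Sum.Base using (inj₁; inj₂)
open import Function.Bundles using (_⇔_; mk⇔)
open import Relation.Binary.PropositionalEquality using (_≡_; _≢_; refl; sym; trans; cong; subst; subst₂)
open import Relation.Nullary.Decidable using (yes; no)
open import Relation.Nullary.Negation using (contradiction)
open import Defs

private
  variable
    n : ℕ

∈-⋃⁺ : ∀ {x : Fin n} {p ps} → p List.∈ ps → x ∈ p → x ∈ ⋃ ps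
∈-⋃⁺ (here refl) x∈p = x∈p∪q⁺ (inj₁ x∈p)
∈-⋃⁺ (there p∈)  x∈p = x∈p∪q⁺ (inj₂ (∈-⋃⁺ p∈ x∈p))

∈-⋃⁻ : ∀ {x : Fin n} ps → x ∈ ⋃ ps → ∃[ p ] p List.∈ ps × x ∈ p
∈-⋃⁻ []       x∈ = contradiction x∈ ∉⊥
∈-⋃⁻ (p ∷ ps) x∈ with x∈p∪q⁻ p (⋃ ps) x∈
... | inj₁ x∈p = p , here refl , x∈p
... | inj₂ x∈⋃ with q , q∈ , x∈q ← ∈-⋃⁻ ps x∈⋃ = q , there q∈ , x∈q

x∈p-y⇒x≢y : ∀ (p : Subset n) {x y} → x ∈ p - y → x ≢ y
x∈p-y⇒x≢y p {x} x∈ refl =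
  -- Deleting `x` a second time would shrink `p - x` strictly, yet deletion is idempotent.
  ⊂-irref (p─q─q≡p─q p ⁅ x ⁆) (x∈p⇒p-x⊂p x∈)

sum-filter-∁ : ∀ (f : Fin n → ℕ) U xs →
  sum (map f (filter (_∈? U) xs)) + sum (map f (filter (_∈? ∁ U) xs)) ≡ sum (map f xs)
sum-filter-∁ f U []       = refl
sum-filter-∁ f U (x ∷ xs) with x ∈? U | x ∈? ∁ U
... | yes x∈U | yes x∈∁ = contradiction x∈U (x∈∁p⇒x∉p x∈∁)
... | yes _   | no _    = trans (+-assoc (f x) _ _) (cong (f x +_) (sum-filter-∁ f U xs))
... | no _    | yes _   = trans (x∙yz≈y∙xz (sum (map f (filter (_∈? U) xs))) (f x) _) (cong (f x +_) (sum-filter-∁ f U xs))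
... | no x∉U  | no x∉∁  = contradiction (x∉∁p⇒x∈p x∉∁) x∉U

module _ (G : VertexWeightedGraph n) where
  open VertexWeightedGraph G

  ∈-Γ[]⁺ : ∀ {U u x} → u ∈ U → x ∈ Γ u → x ∈ Γ[ U ]
  ∈-Γ[]⁺ {U} {u} u∈U = ∈-⋃⁺ (∈-map∘filter⁺ Γ (_∈? U) (u , ∈-allFin u , refl , u∈U))

  ∈-Γ[]⁻ : ∀ U {x} → x ∈ Γ[ U ] → ∃[ u ] u ∈ U × x ∈ Γ u
  ∈-Γ[]⁻ U x∈
    with _ , p∈ , x∈p ← ∈-⋃⁻ (map Γ (members U)) x∈
    with u , _ , refl , u∈U ← ∈-map∘filter⁻ Γ (_∈? U) {xs = allFin _} p∈
    = u , u∈U , x∈p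

  μ[]-∁ : ∀ U V → μ[ U ] + μ[ ∁ U ] ≡ μ[ V ] + μ[ ∁ V ]
  μ[]-∁ U V = trans (sum-filter-∁ μ U (allFin _)) (sym (sum-filter-∁ μ V (allFin _)))

  -- A set and its complement share a fixed total weight. This is what turns a maximum into a
  -- minimum.
  μ[]-∁-antitone : ∀ {U V} → μ[ U ] ≤ μ[ V ] → μ[ ∁ V ] ≤ μ[ ∁ U ]
  μ[]-∁-antitone {U} {V} U≤V = +-cancelˡ-≤ μ[ U ] _ _ (begin
    μ[ U ] + μ[ ∁ V ]  ≤⟨ +-monoˡ-≤ μ[ ∁ V ] U≤V ⟩
    μ[ V ] + μ[ ∁ V ]  ≡⟨ μ[]-∁ V U ⟩
    μ[ U ] + μ[ ∁ U ]  ∎)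
    where open ≤-Reasoning

  Edgeless : Subset n → Set
  Edgeless U = ∀ {x y} → x ∈ U → y ∈ U → y ∉ Γ x

  independent⁻ : ∀ {U} → Independent G U → Edgeless U
  independent⁻ ind x∈U y∈U y∈Γx =
    ∉⊥ (subst (_ ∈_) ind (x∈p∩q⁺ (y∈U , ∈-Γ[]⁺ x∈U y∈Γx)))

  independent⁺ : ∀ {U} → Edgeless U → Independent G U
  independent⁺ {U} edgeless = Empty-unique λ (y , y∈) →
    let y∈U , y∈Γ[U] = x∈p∩q⁻ U Γ[ U ] y∈
        x , x∈U , y∈Γx = ∈-Γ[]⁻ U y∈Γ[U]
    in edgeless x∈U y∈U y∈Γx

  mis-dominating : ∀ {U} → MIS G U → ∀ {x} → x ∉ U → ∃[ u ] u ∈ U × x ∈ Γ u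
  mis-dominating {U} (_ , cover) x∉U
    with x∈p∪q⁻ U Γ[ U ] (subst (_ ∈_) (sym cover) ∈⊤)
  ... | inj₁ x∈U    = contradiction x∈U x∉U
  ... | inj₂ x∈Γ[U] = ∈-Γ[]⁻ U x∈Γ[U]

  -- Independence gives one inclusion, maximality the other. The weight argument can then be carried
  -- out for `∁ U`.
  mis⇒Γ[]≡∁ : ∀ {U} → MIS G U → Γ[ U ] ≡ ∁ U
  mis⇒Γ[]≡∁ {U} mis@(ind , _) = ⊆-antisym
    (λ x∈Γ[U] → let u , u∈U , x∈Γu = ∈-Γ[]⁻ U x∈Γ[U] in
      x∉p⇒x∈∁p λ x∈U → independent⁻ ind u∈U x∈U x∈Γu)
    (λ x∈∁U → let u , u∈U , x∈Γu = mis-dominating mis (x∈∁p⇒x∉p x∈∁U) in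
      ∈-Γ[]⁺ u∈U x∈Γu)

-- Exactly one vertex from each pair. Complementation merely exchanges the two implications.
Transversal : (Fin n → Fin n) → Subset n → Set
Transversal _* U = ∀ x → (x ∈ U → x * ∉ U) × (x ∉ U → x * ∈ U)

∁-transversal : ∀ {_* : Fin n → Fin n} {U} → Transversal _* U → Transversal _* (∁ U)
∁-transversal t x =
  (λ x∈∁U → x∈p⇒x∉∁p (proj₂ (t x) (x∈∁p⇒x∉p x∈∁U))) ,
  (λ x∉∁U → x∉p⇒x∈∁p (proj₁ (t x) (x∉∁p⇒x∈p x∉∁U)))

module _ (G : VertexWeightedGraph n) (T : TwinOrthogonal G) where
  open VertexWeightedGraph G
  open TwinOrthogonal T

  *-adjacent : ∀ x → x * ∈ Γ x
  *-adjacent x = proj₁ (*-orthogonal x)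

  *-exchange : ∀ {x y z} → y ∈ Γ x → y ≢ x * → z ∈ Γ (x *) → z ∈ Γ y
  *-exchange {x} y∈Γx y≢x* z∈Γx* =
    proj₁ (proj₂ (*-orthogonal x)) _ (x∈p∧x≢y⇒x∈p-y y∈Γx y≢x*) z∈Γx*

  mis⇒transversal : ∀ {U} → MIS G U → Transversal _* U
  mis⇒transversal {U} mis@(ind , _) x =
    (λ x∈U x*∈U → independent⁻ G ind x∈U x*∈U (*-adjacent x)) , meets
    where
    meets : x ∉ U → x * ∈ U
    meets x∉U with x * ∈? U
    ... | yes x*∈U = x*∈U
    ... | no  x*∉U
      with u , u∈U , x∈Γu ← mis-dominating G mis x∉U
         | v , v∈U , x*∈Γv ← mis-dominating G mis x*∉U
      = contradiction
          (*-exchange (Γ-sym x∈Γu) (λ u≡x* → x*∉U (subst (_∈ U) u≡x* u∈U)) (Γ-sym x*∈Γv))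
          (independent⁻ G ind u∈U v∈U)

  -- Maximality is automatic: a vertex outside `U` has its partner in `U`, and partners are
  -- adjacent.
  transversal⇒mis : ∀ {U} → Edgeless G U → Transversal _* U → MIS G U
  transversal⇒mis {U} edgeless t = independent⁺ G edgeless , ⊆-antisym ⊆⊤ λ {x} _ → covered x
    where
    covered : ∀ x → x ∈ U ∪ Γ[ U ]
    covered x with x ∈? U
    ... | yes x∈U = x∈p∪q⁺ (inj₁ x∈U)
    ... | no  x∉U = x∈p∪q⁺ (inj₂ (∈-Γ[]⁺ G (proj₂ (t x) x∉U) (Γ-sym (*-adjacent x))))

  private
    G* : VertexWeightedGraph n
    G* = conjugate G T

    module G* = VertexWeightedGraph G*

  Γ*⁺ : ∀ {x y} → Adjacent* G T x y → y ∈ G*.Γ x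
  Γ*⁺ {x} = ∈-subset⁺ (adjacent*? G T x)

  Γ*⁻ : ∀ {x y} → y ∈ G*.Γ x → Adjacent* G T x y
  Γ*⁻ {x} = ∈-subset⁻ (adjacent*? G T x)

  *-swap : ∀ {x y} → x * ≡ y → x ≡ y *
  *-swap refl = sym (*-involutive _)

  -- Outside the pairs, adjacency in `G*` is adjacency of partners in `G`, so the generic case is
  -- `*-exchange` at `x *`. Edges inside a pair are split off first.
  conjugate-exchange : ∀ {x y z} → y ∈ G*.Γ x → y ≢ x * → z ∈ G*.Γ (x *) → z ∈ G*.Γ y
  conjugate-exchange {x} {y} {z} y∈ y≢x* z∈ with Γ*⁻ y∈ | Γ*⁻ z∈ | z ≟ y *
  ... | inj₁ y≡x*         | _                    | _        = contradiction y≡x* y≢x*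
  ... | _                 | _                    | yes z≡y* = Γ*⁺ (inj₁ z≡y*)
  -- Here `z` is `x` itself, and the claim is the edge from `x` to `y` reversed.
  ... | _                 | inj₁ z≡x**           | _        =
    subst (_∈ G*.Γ y) (sym (trans z≡x** (*-involutive x))) (G*.Γ-sym y∈)
  ... | inj₂ (_ , y*∈Γx*) | inj₂ (_ , z*∈Γx**) | no z≢y* =
    Γ*⁺ (inj₂ (z≢y* , *-exchange y*∈Γx* y*≢x** z*∈Γx**))
    where
    y*≢x** : y * ≢ (x *) *
    y*≢x** y*≡x** = y≢x* (trans (*-swap y*≡x**) (*-involutive (x *)))

  conjugate-twinOrthogonal : TwinOrthogonal G*
  conjugate-twinOrthogonal = record
    { _*           = _*
    ; *-involutive = *-involutive
    ; *-orthogonal = λ x →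
        Γ*⁺ (inj₁ refl) ,
        (λ y y∈ → conjugate-exchange (p─q⊆p _ ⁅ x * ⁆ y∈) (x∈p-y⇒x≢y (G*.Γ x) y∈)) ,
        -- The second inclusion is the first one taken at `x *`, whose partner is `x`.
        (λ y y∈ z∈ → conjugate-exchange
          (p─q⊆p _ ⁅ x ⁆ y∈)
          (λ y≡x** → x∈p-y⇒x≢y (G*.Γ (x *)) y∈ (trans y≡x** (*-involutive x)))
          (subst (λ w → _ ∈ G*.Γ w) (sym (*-involutive x)) z∈))
    }

  -- An edge of `G*` inside `∁ U` either joins partners, which a transversal excludes, or is carried
  -- by `_*` to an edge of `G` inside `U`.
  edgeless-∁-conjugate : ∀ {U} → Transversal _* U → Edgeless G U → Edgeless G* (∁ U)
  edgeless-∁-conjugate {U} t edgeless {x} {y} x∈∁U y∈∁U y∈Γ*x with Γ*⁻ y∈Γ*x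
  ... | inj₁ refl           = proj₁ (∁-transversal t x) x∈∁U y∈∁U
  ... | inj₂ (_ , y*∈Γx*) =
    edgeless (proj₂ (t x) (x∈∁p⇒x∉p x∈∁U)) (proj₂ (t y) (x∈∁p⇒x∉p y∈∁U)) y*∈Γx*

  -- Argued directly, since the double conjugate does not have the adjacency of `G` by definition.
  -- An edge of `G` inside `∁ W` cannot join partners, so `_*` carries it to an edge of `G*` inside
  -- `W`.
  conjugate-edgeless-∁ : ∀ {W} → Transversal _* W → Edgeless G* W → Edgeless G (∁ W)
  conjugate-edgeless-∁ {W} t edgeless {x} {y} x∈∁W y∈∁W y∈Γx =
    edgeless (proj₂ (t x) (x∈∁p⇒x∉p x∈∁W)) (proj₂ (t y) (x∈∁p⇒x∉p y∈∁W))
      (Γ*⁺ (inj₂ (y*≢x** , y**∈Γx**)))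
    where
    y*≢x** : y * ≢ (x *) *
    y*≢x** y*≡x** = proj₁ (∁-transversal t x) x∈∁W
      (subst (_∈ ∁ W) (trans (*-swap y*≡x**) (*-involutive (x *))) y∈∁W)
    y**∈Γx** : (y *) * ∈ Γ ((x *) *)
    y**∈Γx** rewrite *-involutive x | *-involutive y = y∈Γx

module _ (G : VertexWeightedGraph n) (T : TwinOrthogonal G) where

  ∁-mis-conjugate : ∀ {U} → MIS G U → MIS (conjugate G T) (∁ U)
  ∁-mis-conjugate mis@(ind , _) =
    transversal⇒mis (conjugate G T) (conjugate-twinOrthogonal G T)
      (edgeless-∁-conjugate G T t (independent⁻ G ind)) (∁-transversal t)
    where t = mis⇒transversal G T mis

  conjugate-mis-∁ : ∀ {W} → MIS (conjugate G T) W → MIS G (∁ W)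
  conjugate-mis-∁ mis@(ind , _) =
    transversal⇒mis G T
      (conjugate-edgeless-∁ G T t (independent⁻ (conjugate G T) ind)) (∁-transversal t)
    -- `W` is maximal independent in the conjugate, so its transversality rests on the conjugate
    -- being twin-orthogonal for the same pairs.
    where t = mis⇒transversal (conjugate G T) (conjugate-twinOrthogonal G T) mis

  mmis⇔mnmis-∁ : ∀ {U} → MIS G U → MMIS G U ⇔ MNMIS (conjugate G T) (∁ U)
  mmis⇔mnmis-∁ {U} mis = mk⇔
    (λ (_ , max) → ∁-mis-conjugate mis , λ W misW →
      -- A competitor `W` is tested through `∁ W`, a MIS of `G`. The conjugate keeps `μ`, so weights
      -- in the two graphs agree by definition.
      subst (λ V → μ[ ∁ U ] ≤ μ[ V ]) (∁-involutive W)
        (μ[]-∁-antitone G (max (∁ W) (conjugate-mis-∁ misW))))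
    (λ (_ , min) → mis , λ V misV →
      subst₂ (λ A B → μ[ A ] ≤ μ[ B ]) (∁-involutive V) (∁-involutive U)
        (μ[]-∁-antitone G (min (∁ V) (∁-mis-conjugate misV))))
    where
    open VertexWeightedGraph G
    open BooleanAlgebra (∪-∩-booleanAlgebra n) using () renaming (¬-involutive to ∁-involutive)

theorem5p3 : (n : ℕ) (G : VertexWeightedGraph n) → Normal G → (T : TwinOrthogonal G) →
    (Û : Subset n) → MIS G Û →
    VertexWeightedGraph.Γ[_] G Û ≡ ∁ Û ×
    (MMIS G Û ⇔ MNMIS (conjugate G T) (VertexWeightedGraph.Γ[_] G Û))
theorem5p3 n G _ T Û mis =
  Γ≡∁ , subst (λ A → MMIS G Û ⇔ MNMIS (conjugate G T) A) (sym Γ≡∁) (mmis⇔mnmis-∁ G T mis)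
  where Γ≡∁ = mis⇒Γ[]≡∁ G mis
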